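{- A hypergraph $\mathcal{H}=([n],\mathcal{E})$ has the unique parent-child property if and only if it is in hyperfect elimination order.
   Context: $[n]=\{1,\ldots,n\}$. A hypergraph $\mathcal{H}=([n],\mathcal{E})$ has $\mathcal{E}\subseteq2^{[n]}$ with all hyperedges nonempty. For $i\le n$, $\mathcal{H}_i$ is the subgraph induced by $[i]$, i.e. the hypergraph on $[i]$ whose hyperedges are those $A\in\mathcal{E}$ with $A\subseteq[i]$. $X-n$ means $X\setminus\{n\}$. Hyperfect elimination order. $\mathcal{H}=([n],\mathcal{E})$ is in hyperfect elimination order if either $n=0$, or $n\ge1$ and: (i) for any two (not necessarily distinct) hyperedges $A,B\in\mathcal{E}$ with $n\in A\cap B$ and any two distinct vertices $a\in A-n$, $b\in B-n$ there is $X\in\mathcal{E}$ with $\{a,b\}\subseteq X\subseteq(A\cup B)-n$; and (ii) $\mathcal{H}_{n-1}$ is in hyperfect elimination order. Orientations. An orientation of $\mathcal{H}$ is a map $h:\mathcal{E}\to[n]$ with $h(A)\in A$ for all $A\in\mathcal{E}$. It is acyclic if the digraph on $[n]$ with an arc $i\to j$ for all distinct $i,j$ such that $i,j\in A$ and $j=h(A)$ for some $A\in\mathcal{E}$ is acyclic. $\mathrm{AO}_{\mathcal{H}}$ is the set of acyclic orientations. For $h\in\mathrm{AO}_{\mathcal{H}}$, $P_{\mathcal{H},h}$ is the poset on $[n]$ given by the transitive closure of: $i\prec j$ if $i\neq j$ and there is $A\in\mathcal{E}$ with $i,j\in A$ and $j=h(A)$. Unique parent-child property. $\mathcal{H}=([n],\mathcal{E})$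 has the unique parent-child property if either $n=0$, or $n\ge1$ and: (i) for every $h\in\mathrm{AO}_{\mathcal{H}}$ the vertex $n$ covers at most one element and is covered by at most one element in $P_{\mathcal{H},h}$; and (ii) $\mathcal{H}_{n-1}$ has the unique parent-child property. -}

module Defs where

open import Data.Bool.Base using (Bool; T)
open import Data.Fin.Base using (Fin; zero; suc; fromℕ)
open import Data.Fin.Subset
  using (Subset; outside; _∈_; _⊆_; _∪_; _-_; ⁅_⁆; Nonempty)
open import Data.Nat.Base using (ℕ; zero; suc)
open import Data.Product.Base using (∃-syntax; _×_; _,_)
open import Data.Unit.Base using (⊤)
open import Data.Vec.Base using ([]; _∷_; _∷ʳ_; here; there)
open import Level using (0ℓ)
open import Relation.Binary.Bundles using (StrictPartialOrder)
open import Relation.Binary.Construct.Closure.Transitive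
  using (TransClosure; transitive)
open import Relation.Binary.Core using (Rel)
open import Relation.Binary.PropositionalEquality
  using (_≡_; _≢_; refl; isEquivalence; resp₂)
open import Relation.Nullary.Negation using (¬_)

private
  variable
    n : ℕ

-- The vertex set [n] = {1,…,n} is Fin n in its usual order, so the vertex n
-- of [n] (for n ≥ 1) is the greatest element  fromℕ _.  The set of
-- hyperedges is a subset of the finite set 2^[n], given by its
-- characteristic function.

record Hypergraph (n : ℕ) : Set where
  field
    isEdge   : Subset n → Bool
    nonempty : ∀ A → T (isEdge A) → Nonempty A

open Hypergraph public

infix 4 _∈ᴱ_

_∈ᴱ_ : Subset n → Hypergraph n → Set
A ∈ᴱ H = T (isEdge H A)

nonempty-∷ʳ⁻ : (A : Subset n) → Nonempty (A ∷ʳ outside) → Nonempty A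
nonempty-∷ʳ⁻ []      (zero  , ())
nonempty-∷ʳ⁻ []      (suc () , _)
nonempty-∷ʳ⁻ (_ ∷ A) (zero  , here) = zero , here
nonempty-∷ʳ⁻ (_ ∷ A) (suc i , there i∈A) with nonempty-∷ʳ⁻ A (i , i∈A)
... | j , j∈A = suc j , there j∈A

-- For H on [n+1], this is H_n.  A subset of [n+1] contained in [n] is
-- exactly one of the form  A ∷ʳ outside  with A a subset of [n].

deleteLast : Hypergraph (suc n) → Hypergraph n
deleteLast H .isEdge   A   = isEdge H (A ∷ʳ outside)
deleteLast H .nonempty A e = nonempty-∷ʳ⁻ A (nonempty H (A ∷ʳ outside) e)

HyperfectEliminationOrder : Hypergraph n → Set
HyperfectEliminationOrder {zero}  H = ⊤
HyperfectEliminationOrder {suc n} H =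
  (∀ A B → A ∈ᴱ H → B ∈ᴱ H → v ∈ A → v ∈ B →
   ∀ a b → a ∈ A - v → b ∈ B - v → a ≢ b →
   ∃[ X ] X ∈ᴱ H × ⁅ a ⁆ ∪ ⁅ b ⁆ ⊆ X × X ⊆ (A ∪ B) - v)
  × HyperfectEliminationOrder (deleteLast H)
  where
  v : Fin (suc n)
  v = fromℕ n

-- The head of A formally depends on a proof of A ∈ᴱ H, but T b has at most
-- one element, so an orientation is a function of the hyperedge alone.

record Orientation (H : Hypergraph n) : Set where
  field
    head   : ∀ A → A ∈ᴱ H → Fin n
    head-∈ : ∀ A (e : A ∈ᴱ H) → head A e ∈ A

open Orientation public

Arc : {H : Hypergraph n} → Orientation H → Rel (Fin n) 0ℓ
Arc {H = H} h i j =
  i ≢ j × (∃[ A ] ∃[ e ] i ∈ A × j ∈ A × j ≡ head {H = H} h A e)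

Acyclic : Rel (Fin n) 0ℓ → Set
Acyclic _⟶_ = ∀ i → ¬ TransClosure _⟶_ i i

record AcyclicOrientation (H : Hypergraph n) : Set where
  field
    orientation : Orientation H
    acyclic     : Acyclic (Arc orientation)

open AcyclicOrientation public

-- The strict part of the poset P_{H,h}.

P : (H : Hypergraph n) → AcyclicOrientation H → StrictPartialOrder 0ℓ 0ℓ 0ℓ
P {n} H h = record
  { Carrier = Fin n
  ; _≈_     = _≡_
  ; _<_     = TransClosure (Arc (orientation h))
  ; isStrictPartialOrder = record
    { isEquivalence = isEquivalence
    ; irrefl        = λ { refl → acyclic h _ }
    ; trans         = transitive (Arc (orientation h))
    ; <-resp-≈      = resp₂ (TransClosure (Arc (orientation h)))
    }
  }

module _ (S : StrictPartialOrder 0ℓ 0ℓ 0ℓ) where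
  open StrictPartialOrder S

  Covers : Rel Carrier 0ℓ
  Covers y x = x < y × ¬ (∃[ z ] x < z × z < y)

  CoversAtMostOne : Carrier → Set
  CoversAtMostOne y = ∀ x x′ → Covers y x → Covers y x′ → x ≈ x′

  CoveredByAtMostOne : Carrier → Set
  CoveredByAtMostOne x = ∀ y y′ → Covers y x → Covers y′ x → y ≈ y′

UniqueParentChild : Hypergraph n → Set
UniqueParentChild {zero}  H = ⊤
UniqueParentChild {suc n} H =
  ((h : AcyclicOrientation H) →
   CoversAtMostOne (P H h) (fromℕ n) × CoveredByAtMostOne (P H h) (fromℕ n))
  × UniqueParentChild (deleteLast H)

{-# OPTIONS --safe #-}
-- If n covers (or is covered by) two elements, the arcs witnessing this lie in
-- hyperedges A and B; the head of the hyperedge X supplied by condition (i)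
-- then refutes one of the covers or closes a cycle.  Conversely, if condition
-- (i) fails for A, B, a, b, orient every hyperedge towards its greatest element
-- in a linear order with blocks
--   A ∪ B - {n, a, b}  <  {a, b}  <  {n}  <  everything else.
-- Then A and B yield arcs a → n and b → n, and both are covers: a path from a
-- to n through another vertex would start with an arc between a and b below n,
-- whose hyperedge would be the missing X.
module Submission where

open import Defs
open import Data.Bool.Properties using (T?)
open import Data.Fin.Base using (Fin; fromℕ; combine; _<_; _≤_)
open import Data.Fin.Patterns using (0F; 1F; 2F; 3F)
open import Data.Fin.Properties
  using (_≟_; _≤?_; ≤-totalOrder; ≤∧≢⇒<; combine-monoˡ-<; combine-injectiveʳ)
open import Data.Fin.Subset
  using (Subset; inside; _∈_; _∉_; _⊆_; _∪_; _─_; _-_; ⁅_⁆; Nonempty)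
open import Data.Fin.Subset.Properties
  using (_∈?_; _⊆?_; anySubset?; x∈⁅x⁆; x∈⁅y⁆⇒x≡y; x∈p∪q⁻; p⊆p∪q; q⊆p∪q;
         p─q⊆p; x∈p∧x≢y⇒x∈p-y)
open import Data.List.Base using (allFin; filter)
open import Data.List.Extrema using (argmax; argmax-all; f[xs]≤f[argmax])
open import Data.List.Membership.Propositional.Properties
  using (∈-allFin; ∈-filter⁺)
open import Data.List.Relation.Unary.All using (lookup)
open import Data.List.Relation.Unary.All.Properties using (all-filter)
open import Data.Nat.Base using (ℕ; zero; suc; z≤n; s≤s)
open import Data.Nat.Properties
  using (<-irrefl; <-trans; ≤-trans; ≤-<-trans; <⇒≤; <⇒≱; ≰⇒>)
open import Data.Product.Base using (∃-syntax; _×_; _,_; proj₁)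
open import Data.Sum.Base using (_⊎_; inj₁; inj₂; [_,_]′)
open import Data.Unit.Base using (tt)
open import Data.Vec.Base using (_∷_; here; there)
open import Function.Base using (_∘_; _∋_)
open import Function.Bundles using (_⇔_; mk⇔)
open import Function.Definitions using (Injective)
open import Relation.Binary.Construct.Closure.Transitive
  using (TransClosure; [_]; _∷_)
open import Relation.Binary.PropositionalEquality
  using (_≡_; _≢_; refl; sym; trans; subst)
open import Relation.Nullary.Decidable
  using (yes; no; _×-dec_; decidable-stable)
open import Relation.Nullary.Negation using (¬_; contradiction)

private
  variable
    m n : ℕ

-- Subsets with a vertex removed, and pairs of vertices

x∈p─q⇒x∉q : ∀ (p q : Subset n) {x} → x ∈ p ─ q → x ∉ q
x∈p─q⇒x∉q (_ ∷ _) (inside ∷ _) () here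
x∈p─q⇒x∉q (_ ∷ p) (_ ∷ q) (there x∈p─q) (there x∈q) = x∈p─q⇒x∉q p q x∈p─q x∈q

x∈p-y⇒x≢y : ∀ (p : Subset n) {x y} → x ∈ p - y → x ≢ y
x∈p-y⇒x≢y p x∈p-y refl = x∈p─q⇒x∉q p ⁅ _ ⁆ x∈p-y (x∈⁅x⁆ _)

⁅x⁆∪⁅y⁆⁻ : ∀ {x y z : Fin n} → z ∈ ⁅ x ⁆ ∪ ⁅ y ⁆ → z ≡ x ⊎ z ≡ y
⁅x⁆∪⁅y⁆⁻ {x = x} {y} z∈ with x∈p∪q⁻ ⁅ x ⁆ ⁅ y ⁆ z∈
... | inj₁ z∈⁅x⁆ = inj₁ (x∈⁅y⁆⇒x≡y x z∈⁅x⁆)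
... | inj₂ z∈⁅y⁆ = inj₂ (x∈⁅y⁆⇒x≡y y z∈⁅y⁆)

⁅x⁆∪⁅y⁆⊆ : ∀ {x y : Fin n} {p : Subset n} → x ∈ p → y ∈ p → ⁅ x ⁆ ∪ ⁅ y ⁆ ⊆ p
⁅x⁆∪⁅y⁆⊆ x∈p y∈p z∈ with ⁅x⁆∪⁅y⁆⁻ z∈
... | inj₁ refl = x∈p
... | inj₂ refl = y∈p

x∈⁅x⁆∪⁅y⁆ : ∀ (x y : Fin n) → x ∈ ⁅ x ⁆ ∪ ⁅ y ⁆
x∈⁅x⁆∪⁅y⁆ x y = p⊆p∪q ⁅ y ⁆ (x∈⁅x⁆ x)

y∈⁅x⁆∪⁅y⁆ : ∀ (x y : Fin n) → y ∈ ⁅ x ⁆ ∪ ⁅ y ⁆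
y∈⁅x⁆∪⁅y⁆ x y = q⊆p∪q ⁅ x ⁆ ⁅ y ⁆ (x∈⁅x⁆ y)

-- An arc inside the pair may run in either direction; both directions place the whole pair in the
-- hyperedge of the arc.
distinct-pair-⊆ : ∀ {x y z w : Fin n} {p : Subset n} →
                  z ∈ ⁅ x ⁆ ∪ ⁅ y ⁆ → w ∈ ⁅ x ⁆ ∪ ⁅ y ⁆ → z ≢ w →
                  z ∈ p → w ∈ p → ⁅ x ⁆ ∪ ⁅ y ⁆ ⊆ p
distinct-pair-⊆ z∈ w∈ z≢w z∈p w∈p with ⁅x⁆∪⁅y⁆⁻ z∈ | ⁅x⁆∪⁅y⁆⁻ w∈
... | inj₁ refl | inj₁ refl = contradiction refl z≢w
... | inj₁ refl | inj₂ refl = ⁅x⁆∪⁅y⁆⊆ z∈p w∈p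
... | inj₂ refl | inj₁ refl = ⁅x⁆∪⁅y⁆⊆ w∈p z∈p
... | inj₂ refl | inj₂ refl = contradiction refl z≢w

-- Condition (i) at an arbitrary vertex `v` in place of the last one. It is compared with
-- `AtMostOneParentAndChild` at the same `v` in one fixed hypergraph, so the recursion through
-- `deleteLast` stays out of the argument.
EliminationCondition : Hypergraph n → Fin n → Set
EliminationCondition H v =
  ∀ A B → A ∈ᴱ H → B ∈ᴱ H → v ∈ A → v ∈ B →
  ∀ a b → a ∈ A - v → b ∈ B - v → a ≢ b →
  ∃[ X ] X ∈ᴱ H × ⁅ a ⁆ ∪ ⁅ b ⁆ ⊆ X × X ⊆ (A ∪ B) - v

AtMostOneParentAndChild : Hypergraph n → Fin n → Set
AtMostOneParentAndChild H v = (h : AcyclicOrientation H) →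
  CoversAtMostOne (P H h) v × CoveredByAtMostOne (P H h) v

-- From the elimination condition to a unique parent and child

module _ (H : Hypergraph n) (h : AcyclicOrientation H) where

  private
    o : Orientation H
    o = orientation h

    infix 4 _⟶_
    _⟶_ : Fin n → Fin n → Set
    _⟶_ = Arc o

  -- The first arc of a longer path ends strictly between `x` and `y`.
  covers⇒arc : ∀ {x y} → Covers (P H h) y x → x ⟶ y
  covers⇒arc ([ x⟶y ]   , _)       = x⟶y
  covers⇒arc (x⟶z ∷ z≺y , nothing) =
    contradiction (_ , [ x⟶z ] , z≺y) nothing

  covers⇒¬arcs : ∀ {x y z} → Covers (P H h) y x → x ⟶ z → ¬ z ⟶ y
  covers⇒¬arcs (_ , nothing) x⟶z z⟶y = nothing (_ , [ x⟶z ] , [ z⟶y ])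

  arc-to-head : ∀ {A i j} (e : A ∈ᴱ H) → i ∈ A → j ≡ head o A e → i ≢ j → i ⟶ j
  arc-to-head e i∈A refl i≢j = i≢j , _ , e , i∈A , head-∈ o _ e , refl

  -- Since `v` is the head of both `A` and `B`, the head `z` of `X` has an arc to `v`. A child of
  -- `v` in `X` other than `z` would have an arc to `z`, which then lies strictly between. So both
  -- children equal `z`.
  eliminationCondition⇒coversAtMostOne :
    ∀ {v} → EliminationCondition H v → CoversAtMostOne (P H h) v
  eliminationCondition⇒coversAtMostOne {v} elim x x′ v⋗x v⋗x′
    with covers⇒arc v⋗x | covers⇒arc v⋗x′
  ... | x≢v  , A , eA , x∈A  , v∈A , v≡headA
      | x′≢v , B , eB , x′∈B , v∈B , v≡headB =
    decidable-stable (x ≟ x′) λ x≢x′ →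
      let X , eX , xx′⊆X , X⊆ = elim A B eA eB v∈A v∈B x x′
            (x∈p∧x≢y⇒x∈p-y x∈A x≢v) (x∈p∧x≢y⇒x∈p-y x′∈B x′≢v) x≢x′
          z   = head o X eX
          z∈  = X⊆ (head-∈ o X eX)
          z≢v = x∈p-y⇒x≢y (A ∪ B) z∈
          z⟶v = [ (λ z∈A → arc-to-head eA z∈A v≡headA z≢v)
                 , (λ z∈B → arc-to-head eB z∈B v≡headB z≢v)
                 ]′ (x∈p∪q⁻ A B (p─q⊆p (A ∪ B) ⁅ v ⁆ z∈))
          child≡z = λ w w∈X v⋗w → decidable-stable (w ≟ z) λ w≢z →
            covers⇒¬arcs v⋗w (arc-to-head eX w∈X refl w≢z) z⟶v
      in x≢x′ (trans (child≡z x  (xx′⊆X (x∈⁅x⁆∪⁅y⁆ x x′)) v⋗x)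
                (sym (child≡z x′ (xx′⊆X (y∈⁅x⁆∪⁅y⁆ x x′)) v⋗x′)))

  eliminationCondition⇒coveredByAtMostOne :
    ∀ {v} → EliminationCondition H v → CoveredByAtMostOne (P H h) v
  eliminationCondition⇒coveredByAtMostOne {v} elim y y′ y⋗v y′⋗v
    with covers⇒arc y⋗v | covers⇒arc y′⋗v
  ... | v≢y  , A , eA , v∈A , y∈A  , y≡headA
      | v≢y′ , B , eB , v∈B , y′∈B , y′≡headB =
    decidable-stable (y ≟ y′) λ y≢y′ →
      let X , eX , yy′⊆X , X⊆ = elim A B eA eB v∈A v∈B y y′
            (x∈p∧x≢y⇒x∈p-y y∈A (v≢y ∘ sym))
            (x∈p∧x≢y⇒x∈p-y y′∈B (v≢y′ ∘ sym)) y≢y′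
          y∈X  = yy′⊆X (x∈⁅x⁆∪⁅y⁆ y y′)
          y′∈X = yy′⊆X (y∈⁅x⁆∪⁅y⁆ y y′)
      in y≢y′ ([ (λ z∈A → parents≡ eX y∈X y′∈X (covers⇒arc y′⋗v) y⋗v eA y≡headA z∈A)
               -- If the head of `X` lies in `B`, the two parents exchange roles.
               , (λ z∈B → sym (parents≡ eX y′∈X y∈X (covers⇒arc y⋗v) y′⋗v eB y′≡headB z∈B))
               ]′ (x∈p∪q⁻ A B (p─q⊆p (A ∪ B) ⁅ v ⁆ (X⊆ (head-∈ o X eX)))))
    where
    -- `C` is the one of `A` and `B` containing the head `z` of `X`, and `p` is the parent that is
    -- its head. If `p` differed from `z`, then `X` and `C` would give the cycle p → z → p. So `p`
    -- is the head of `X`, and `q` distinct from `p` would give v → q → p, against the cover.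
    parents≡ : ∀ {X C p q} (eX : X ∈ᴱ H) → p ∈ X → q ∈ X →
               v ⟶ q → Covers (P H h) p v →
               (eC : C ∈ᴱ H) → p ≡ head o C eC → head o X eX ∈ C → p ≡ q
    parents≡ {X} {p = p} {q} eX p∈X q∈X v⟶q p⋗v eC p≡headC z∈C =
      trans p≡z (sym q≡z)
      where
      p≡z : p ≡ head o X eX
      p≡z = decidable-stable (p ≟ _) λ p≢z →
        acyclic h p ( arc-to-head eX p∈X refl p≢z
                    ∷ [ arc-to-head eC z∈C p≡headC (p≢z ∘ sym) ])

      q≡z : q ≡ head o X eX
      q≡z = decidable-stable (q ≟ _) λ q≢z →
        covers⇒¬arcs p⋗v v⟶q
          (arc-to-head eX q∈X p≡z λ q≡p → q≢z (trans q≡p p≡z))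

-- Orienting hyperedges towards their greatest vertex

module _ (f : Fin n → Fin m) where

  private
    greatest : (A : Subset n) → Nonempty A → Fin n
    greatest A (x , _) =
      -- The default value `x` is the witness of nonemptiness, so the result lies in `A` whichever
      -- candidate wins.
      argmax (≤-totalOrder m) f x (filter (_∈? A) (allFin n))

    greatest-∈ : ∀ A (ne : Nonempty A) → greatest A ne ∈ A
    greatest-∈ A (x , x∈A) =
      argmax-all (≤-totalOrder m) f x∈A (all-filter (_∈? A) (allFin n))

    ≤-greatest : ∀ A (ne : Nonempty A) {i} → i ∈ A → f i ≤ f (greatest A ne)
    ≤-greatest A (x , _) {i} i∈A =
      lookup (f[xs]≤f[argmax] (≤-totalOrder m) x (filter (_∈? A) (allFin n)))
             (∈-filter⁺ (_∈? A) (∈-allFin i) i∈A)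

  greatestOrientation : (H : Hypergraph n) → Orientation H
  greatestOrientation H .head   A e = greatest A (nonempty H A e)
  greatestOrientation H .head-∈ A e = greatest-∈ A (nonempty H A e)

  ≤-head : ∀ {H A} (e : A ∈ᴱ H) {i} → i ∈ A →
           f i ≤ f (head (greatestOrientation H) A e)
  ≤-head {H} {A} e = ≤-greatest A (nonempty H A e)

  module _ (inj : Injective _≡_ _≡_ f) (H : Hypergraph n) where

    -- The head maximises `f` on its hyperedge, and injectivity makes the inequality strict at any
    -- other vertex. Hence `f` increases along paths and no cycle exists.
    arc⇒< : ∀ {i j} → Arc (greatestOrientation H) i j → f i < f j
    arc⇒< (i≢j , A , e , i∈A , _ , refl) =
      ≤∧≢⇒< (≤-head {H} e i∈A) (i≢j ∘ inj)

    path⇒< : ∀ {i j} → TransClosure (Arc (greatestOrientation H)) i j → f i < f j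
    path⇒< [ r ]    = arc⇒< r
    path⇒< (r ∷ rs) = <-trans (arc⇒< r) (path⇒< rs)

    greatestAcyclicOrientation : AcyclicOrientation H
    greatestAcyclicOrientation .orientation   = greatestOrientation H
    greatestAcyclicOrientation .acyclic i i≺i = <-irrefl refl (path⇒< i≺i)

-- The block order and the covers it produces

-- Q and C stand for {a, b} and A ∪ B - n.
module BlockOrder (H : Hypergraph n) (Q C : Subset n) (v : Fin n)
                  (Q⊆C : Q ⊆ C) (v∉C : v ∉ C) where

  -- As `Q` lies inside `C`, it has to be tested first; block `0F` is then `C` without `Q`.
  block : Fin n → Fin 4
  block z with z ∈? Q | z ∈? C | z ≟ v
  ... | yes _ | _     | _     = 1F
  ... | no _  | yes _ | _     = 0F
  ... | no _  | no _  | yes _ = 2F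
  ... | no _  | no _  | no _  = 3F

  block-v : block v ≡ 2F
  block-v with v ∈? Q | v ∈? C | v ≟ v
  ... | yes v∈Q | _       | _      = contradiction (Q⊆C v∈Q) v∉C
  ... | no _    | yes v∈C | _      = contradiction v∈C v∉C
  ... | no _    | no _    | yes _  = refl
  ... | no _    | no _    | no v≢v = contradiction refl v≢v

  ∈C⇒block<2 : ∀ {z} → z ∈ C → block z < (Fin 4 ∋ 2F)
  ∈C⇒block<2 {z} z∈C with z ∈? Q | z ∈? C | z ≟ v
  ... | yes _ | _      | _ = s≤s (s≤s z≤n)
  ... | no _  | yes _  | _ = s≤s z≤n
  ... | no _  | no z∉C | _ = contradiction z∈C z∉C

  block≤2⇒∈C : ∀ {z} → block z ≤ (Fin 4 ∋ 2F) → z ≢ v → z ∈ C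
  block≤2⇒∈C {z} le z≢v with z ∈? Q | z ∈? C | z ≟ v
  ... | yes z∈Q | _       | _       = Q⊆C z∈Q
  ... | no _    | yes z∈C | _       = z∈C
  ... | no _    | no _    | yes z≡v = contradiction z≡v z≢v
  block≤2⇒∈C {z} (s≤s (s≤s ())) z≢v | no _ | no _ | no _

  ∈Q⇒1≤block : ∀ {z} → z ∈ Q → (Fin 4 ∋ 1F) ≤ block z
  ∈Q⇒1≤block {z} z∈Q with z ∈? Q | z ∈? C | z ≟ v
  ... | yes _   | _ | _ = s≤s z≤n
  ... | no z∉Q  | _ | _ = contradiction z∈Q z∉Q

  ∈C∧1≤block⇒∈Q : ∀ {z} → z ∈ C → (Fin 4 ∋ 1F) ≤ block z → z ∈ Q
  ∈C∧1≤block⇒∈Q {z} z∈C le with z ∈? Q | z ∈? C | z ≟ v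
  ... | yes z∈Q | _      | _ = z∈Q
  ... | no _    | no z∉C | _ = contradiction z∈C z∉C
  ∈C∧1≤block⇒∈Q {z} z∈C () | no _ | yes _ | _

  -- A lexicographic rank: the block is the leading digit, and the vertex itself breaks ties, which
  -- refines the blocks to a linear order.
  rank : Fin n → Fin _
  rank z = combine (block z) z

  rank-injective : Injective _≡_ _≡_ rank
  rank-injective {x} {y} = combine-injectiveʳ (block x) x (block y) y

  rank≤⇒block≤ : ∀ x y → rank x ≤ rank y → block x ≤ block y
  rank≤⇒block≤ x y le = decidable-stable (block x ≤? block y) λ ≰ →
    <⇒≱ (combine-monoˡ-< y x (≰⇒> ≰)) le

  rank≤v⇒∈C : ∀ {z} → rank z ≤ rank v → z ≢ v → z ∈ C
  rank≤v⇒∈C {z} le =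
    block≤2⇒∈C (subst (block z ≤_) block-v (rank≤⇒block≤ z v le))

  ∈C⇒rank<v : ∀ {z} → z ∈ C → rank z < rank v
  ∈C⇒rank<v {z} z∈C =
    combine-monoˡ-< z v (subst (block z <_) (sym block-v) (∈C⇒block<2 z∈C))

  o : AcyclicOrientation H
  o = greatestAcyclicOrientation rank rank-injective H

  -- Every vertex of `C` ranks below `v`, so a head of `A` other than `v` would be smaller than the
  -- vertex `v` of `A`.
  arc-to-v : ∀ {A} → A ∈ᴱ H → v ∈ A → A - v ⊆ C → ∀ {x} → x ∈ A - v →
             Arc (orientation o) x v
  arc-to-v {A} e v∈A A-v⊆C x∈ =
    x∈p-y⇒x≢y A x∈ , A , e , p─q⊆p A ⁅ v ⁆ x∈ , v∈A ,
    decidable-stable (v ≟ z) λ v≢z →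
      <⇒≱ (∈C⇒rank<v (A-v⊆C (x∈p∧x≢y⇒x∈p-y (head-∈ (orientation o) A e) (v≢z ∘ sym))))
          (≤-head rank {H} e v∈A)
    where
    z : Fin n
    z = head (orientation o) A e

  -- All of `X` ranks at most as high as its head `w`, hence below `v`, and only vertices of `C`
  -- rank there. Within `C`, the vertices of `Q` form the top block, so `w`, ranking above `x`, is
  -- again in `Q`.
  arc-below-v : ∀ {x w} → x ∈ Q → Arc (orientation o) x w → rank w < rank v →
                w ∈ Q × x ≢ w × (∃[ X ] X ∈ᴱ H × x ∈ X × w ∈ X × X ⊆ C)
  arc-below-v {x} {w} x∈Q x⟶w@(x≢w , X , e , x∈X , w∈X , w≡head) w<v =
    ∈C∧1≤block⇒∈Q (X⊆C w∈X) 1≤block , x≢w , X , e , x∈X , w∈X , X⊆C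
    where
    X⊆C : X ⊆ C
    X⊆C {u} u∈X = rank≤v⇒∈C (<⇒≤ u<v) λ { refl → <-irrefl refl u<v }
      where
      u≤w : rank u ≤ rank w
      u≤w = subst (λ j → rank u ≤ rank j) (sym w≡head) (≤-head rank {H} e u∈X)

      u<v : rank u < rank v
      u<v = ≤-<-trans u≤w w<v

    1≤block : (Fin 4 ∋ 1F) ≤ block w
    1≤block = ≤-trans (∈Q⇒1≤block x∈Q)
      (rank≤⇒block≤ x w (<⇒≤ (arc⇒< rank rank-injective H x⟶w)))

  -- Ranks rise along paths, so if some `z` lay between `x` and `v`, the first arc of the path from
  -- `x` to `z` would end below `v`. By `arc-below-v` its hyperedge is one that `no-edge` forbids.
  covers-v : (∀ {x w X} → x ∈ Q → w ∈ Q → x ≢ w → X ∈ᴱ H → x ∈ X → w ∈ X → ¬ X ⊆ C) →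
             ∀ {x} → x ∈ Q → Arc (orientation o) x v → Covers (P H o) v x
  covers-v no-edge {x} x∈Q x⟶v = [ x⟶v ] , λ (z , x≺z , z≺v) →
    ¬path x≺z (path⇒< rank rank-injective H z≺v)
    where
    ¬arc : ∀ {w} → Arc (orientation o) x w → ¬ rank w < rank v
    ¬arc x⟶w w<v with arc-below-v x∈Q x⟶w w<v
    ... | w∈Q , x≢w , X , e , x∈X , w∈X , X⊆C = no-edge x∈Q w∈Q x≢w e x∈X w∈X X⊆C

    ¬path : ∀ {z} → TransClosure (Arc (orientation o)) x z → ¬ rank z < rank v
    ¬path [ x⟶z ]     z<v = ¬arc x⟶z z<v
    ¬path (x⟶w ∷ w≺z) z<v = ¬arc x⟶w
      (<-trans (path⇒< rank rank-injective H w≺z) z<v)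

-- From unique children to the elimination condition

atMostOneParentAndChild⇒eliminationCondition :
  ∀ (H : Hypergraph n) v → AtMostOneParentAndChild H v → EliminationCondition H v
atMostOneParentAndChild⇒eliminationCondition H v unique A B eA eB v∈A v∈B a b a∈ b∈ a≢b =
  -- There are finitely many candidates for `X` and each is decidable, so refuting the absence of
  -- `X` yields an actual `X`.
  decidable-stable
    (anySubset? λ X → T? (isEdge H X) ×-dec (⁅ a ⁆ ∪ ⁅ b ⁆ ⊆? X) ×-dec (X ⊆? (A ∪ B) - v))
    λ no-X →
      let
        cover = covers-v λ x∈Q w∈Q x≢w e x∈X w∈X X⊆C →
          no-X (_ , e , distinct-pair-⊆ x∈Q w∈Q x≢w x∈X w∈X , X⊆C)
      in a≢b (proj₁ (unique o) a b
           (cover (x∈⁅x⁆∪⁅y⁆ a b) (arc-to-v eA v∈A A-v⊆C a∈))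
           (cover (y∈⁅x⁆∪⁅y⁆ a b) (arc-to-v eB v∈B B-v⊆C b∈)))
  where
  A-v⊆C : A - v ⊆ (A ∪ B) - v
  A-v⊆C x∈ = x∈p∧x≢y⇒x∈p-y (p⊆p∪q B (p─q⊆p A ⁅ v ⁆ x∈)) (x∈p-y⇒x≢y A x∈)

  B-v⊆C : B - v ⊆ (A ∪ B) - v
  B-v⊆C x∈ = x∈p∧x≢y⇒x∈p-y (q⊆p∪q A B (p─q⊆p B ⁅ v ⁆ x∈)) (x∈p-y⇒x≢y B x∈)

  open BlockOrder H (⁅ a ⁆ ∪ ⁅ b ⁆) ((A ∪ B) - v) v
    (⁅x⁆∪⁅y⁆⊆ (A-v⊆C a∈) (B-v⊆C b∈)) (λ v∈ → x∈p-y⇒x≢y (A ∪ B) v∈ refl)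

-- Induction on the number of vertices

uniqueParentChild⇒hyperfect :
  ∀ n (H : Hypergraph n) → UniqueParentChild H → HyperfectEliminationOrder H
uniqueParentChild⇒hyperfect zero    H _             = tt
uniqueParentChild⇒hyperfect (suc n) H (unique , upc) =
  atMostOneParentAndChild⇒eliminationCondition H (fromℕ n) unique ,
  uniqueParentChild⇒hyperfect n (deleteLast H) upc

hyperfect⇒uniqueParentChild :
  ∀ n (H : Hypergraph n) → HyperfectEliminationOrder H → UniqueParentChild H
hyperfect⇒uniqueParentChild zero    H _            = tt
hyperfect⇒uniqueParentChild (suc n) H (elim , heo) =
  (λ h → eliminationCondition⇒coversAtMostOne H h elim ,
         eliminationCondition⇒coveredByAtMostOne H h elim) ,
  hyperfect⇒uniqueParentChild n (deleteLast H) heo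

lemma10 : (n : ℕ) (H : Hypergraph n) → UniqueParentChild H ⇔ HyperfectEliminationOrder H
lemma10 n H =
  mk⇔ (uniqueParentChild⇒hyperfect n H) (hyperfect⇒uniqueParentChild n H)
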